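{- Let $1\le k<m$ be integers, let $N>(2^m)!$ be an integer, and let $f^*:2^{[m]}\to\mathbb{R}$ be the set function with $f^*(\emptyset)=0$ whose $W$-coefficients are $w(S)=N$ for all non-empty $S\subseteq[m]$ with $|S|\le k$ and $w(S)=-1$ for all $S\subseteq[m]$ with $|S|>k$. Then any certificate of non-coverageness of $f^*$ has size at least $2^k$; that is, if $\mathcal{J}\subseteq 2^{[m]}$ is such that no coverage function $f$ satisfies $f(T)=f^*(T)$ for all $T\in\mathcal{J}$, then $|\mathcal{J}|\ge 2^k$.
   Context: $[m]=\{1,\dots,m\}$. A function $f:2^{[m]}\to\mathbb{R}_{\ge 0}$ is a coverage function if there exist a finite set $U$, weights $w_u\ge 0$ for $u\in U$, and sets $A_1,\dots,A_m\subseteq U$ such that $f(T)=\sum_{u\in\bigcup_{i\in T}A_i} w_u$ for all $T\subseteq[m]$. The $W$-coefficients of a set function $f$ with $f(\emptyset)=0$ are, for each non-empty $S\subseteq[m]$, $w(S)=\sum_{T:\,S\cup T=[m]}(-1)^{|S\cap T|+1}f(T)$; equivalently they are the unique reals with $f(T)=\sum_{S:\,S\cap T\ne\emptyset}w(S)$ for all $T\subseteq[m]$. A certificate of non-coverageness of a set function $g$ is a collection $\mathcal{J}$ of subsets of $[m]$ such that no coverage function agrees with $g$ on all sets of $\mathcal{J}$; its size is $|\mathcal{J}|$. -}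

module Defs where

open import Algebra.Bundles using (CommutativeMonoid)
open import Data.Bool.Properties as Bool using ()
open import Data.Fin.Base using (Fin)
open import Data.Fin.Subset using (Subset; inside; outside; _∪_; _∩_; ∣_∣; ⊤; ⋃)
open import Data.Fin.Subset.Properties using (_∈?_)
open import Data.Integer.Base as ℤ using (ℤ; 0ℤ)
open import Data.List.Base using (List; []; _∷_; _++_; map; filter; foldr; allFin)
open import Data.List.Membership.Propositional using () renaming (_∈_ to _∈ˡ_)
open import Data.Nat.Base as ℕ using (ℕ; zero; suc)
open import Data.Nat.Properties as ℕₚ using ()
open import Data.Product.Base using (∃; _×_; _,_)
open import Data.Rational.Base as ℚ using (ℚ; 0ℚ; ½)
open import Data.Rational.Properties as ℚₚ using ()
open import Data.Vec.Base using ([]; _∷_)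
open import Data.Vec.Properties as Vec using ()
open import Relation.Binary.Definitions using (DecidableEquality)
open import Relation.Binary.PropositionalEquality using (_≡_; refl; sym; trans; cong; subst)
open import Relation.Nullary using (¬_)

-- Real numbers: Cauchy sequences of rationals, with ≃ (the difference tends to
-- zero) as equality.

Cauchy : (ℕ → ℚ) → Set
Cauchy x = ∀ ε → 0ℚ ℚ.< ε →
  ∃ λ N → ∀ m n → N ℕ.≤ m → N ℕ.≤ n → ℚ.∣ x m ℚ.- x n ∣ ℚ.< ε

record ℝ : Set where
  constructor mkℝ
  field
    seq    : ℕ → ℚ
    cauchy : Cauchy seq

open ℝ public

infix 4 _≃_ _≤_

_≃_ : ℝ → ℝ → Set
x ≃ y = ∀ ε → 0ℚ ℚ.< ε →
  ∃ λ N → ∀ n → N ℕ.≤ n → ℚ.∣ seq x n ℚ.- seq y n ∣ ℚ.< ε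

_≤_ : ℝ → ℝ → Set
x ≤ y = ∀ ε → 0ℚ ℚ.< ε →
  ∃ λ N → ∀ n → N ℕ.≤ n → seq x n ℚ.< seq y n ℚ.+ ε

fromℚ : ℚ → ℝ
fromℚ q = mkℝ (λ _ → q) λ ε ε>0 →
  0 , λ _ _ _ _ → subst (λ d → ℚ.∣ d ∣ ℚ.< ε) (sym (ℚₚ.+-inverseʳ q)) ε>0

fromℤ : ℤ → ℝ
fromℤ i = fromℚ (i ℚ./ 1)

0ℝ : ℝ
0ℝ = fromℤ 0ℤ

infixl 6 _+_
infix  8 -_

private
  half>0 : ∀ ε → 0ℚ ℚ.< ε → 0ℚ ℚ.< ½ ℚ.* ε
  half>0 ε ε>0 = subst (ℚ._< ½ ℚ.* ε) (ℚₚ.*-zeroʳ ½) (ℚₚ.*-monoʳ-<-pos ½ ε>0)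

  half+half : ∀ ε → ½ ℚ.* ε ℚ.+ ½ ℚ.* ε ≡ ε
  half+half ε = trans (sym (ℚₚ.*-distribʳ-+ ε ½ ½)) (ℚₚ.*-identityˡ ε)

  open import Algebra.Properties.CommutativeSemigroup
    (CommutativeMonoid.commutativeSemigroup ℚₚ.+-0-commutativeMonoid)
    using (interchange)

  +-difference : ∀ a b c d →
    (a ℚ.+ b) ℚ.- (c ℚ.+ d) ≡ (a ℚ.- c) ℚ.+ (b ℚ.- d)
  +-difference a b c d = trans
    (cong ((a ℚ.+ b) ℚ.+_) (ℚₚ.neg-distrib-+ c d))
    (interchange a b (ℚ.- c) (ℚ.- d))

_+_ : ℝ → ℝ → ℝ
x + y = mkℝ (λ n → seq x n ℚ.+ seq y n) cauchy-+
  where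
  cauchy-+ : Cauchy (λ n → seq x n ℚ.+ seq y n)
  cauchy-+ ε ε>0 with cauchy x (½ ℚ.* ε) (half>0 ε ε>0) | cauchy y (½ ℚ.* ε) (half>0 ε ε>0)
  ... | M , x-close | N , y-close = M ℕ.⊔ N , λ m n m≥ n≥ → begin-strict
    ℚ.∣ (seq x m ℚ.+ seq y m) ℚ.- (seq x n ℚ.+ seq y n) ∣
      ≡⟨ cong ℚ.∣_∣ (+-difference (seq x m) (seq y m) (seq x n) (seq y n)) ⟩
    ℚ.∣ (seq x m ℚ.- seq x n) ℚ.+ (seq y m ℚ.- seq y n) ∣
      ≤⟨ ℚₚ.∣p+q∣≤∣p∣+∣q∣ (seq x m ℚ.- seq x n) (seq y m ℚ.- seq y n) ⟩
    ℚ.∣ seq x m ℚ.- seq x n ∣ ℚ.+ ℚ.∣ seq y m ℚ.- seq y n ∣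
      <⟨ ℚₚ.+-mono-<
           (x-close m n (ℕₚ.m⊔n≤o⇒m≤o M N m≥) (ℕₚ.m⊔n≤o⇒m≤o M N n≥))
           (y-close m n (ℕₚ.m⊔n≤o⇒n≤o M N m≥) (ℕₚ.m⊔n≤o⇒n≤o M N n≥)) ⟩
    ½ ℚ.* ε ℚ.+ ½ ℚ.* ε
      ≡⟨ half+half ε ⟩
    ε ∎
    where open ℚₚ.≤-Reasoning

-_ : ℝ → ℝ
- x = mkℝ (λ n → ℚ.- seq x n) cauchy-neg
  where
  cauchy-neg : Cauchy (λ n → ℚ.- seq x n)
  cauchy-neg ε ε>0 with cauchy x ε ε>0
  ... | N , close = N , λ m n m≥ n≥ →
    subst (ℚ._< ε)
      (trans (sym (ℚₚ.∣-p∣≡∣p∣ (seq x m ℚ.- seq x n)))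
             (cong ℚ.∣_∣ (ℚₚ.neg-distrib-+ (seq x m) (ℚ.- seq x n))))
      (close m n m≥ n≥)

∑ : {A : Set} → List A → (A → ℝ) → ℝ
∑ xs f = foldr (λ a s → f a + s) 0ℝ xs

-- signed n x is (-1)ⁿ x.
signed : ℕ → ℝ → ℝ
signed zero    x = x
signed (suc n) x = - signed n x

-- The ground set {1, …, m} is Fin m, so a set function on it is a function
-- Subset m → ℝ.

SetFunction : ℕ → Set
SetFunction m = Subset m → ℝ

allSubsets : ∀ m → List (Subset m)
allSubsets zero    = [] ∷ []
allSubsets (suc m) =
  map (outside ∷_) (allSubsets m) ++ map (inside ∷_) (allSubsets m)

_≟_ : ∀ {m} → DecidableEquality (Subset m)
_≟_ = Vec.≡-dec Bool._≟_

elements : ∀ {n} → Subset n → List (Fin n)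
elements {n} T = filter (_∈? T) (allFin n)

record IsCoverage {m : ℕ} (f : SetFunction m) : Set where
  field
    f-nonneg : ∀ T → 0ℝ ≤ f T
    size     : ℕ                     -- the finite set U is Fin size
    weight   : Fin size → ℝ
    w-nonneg : ∀ u → 0ℝ ≤ weight u
    A        : Fin m → Subset size
    f-covers : ∀ T → f T ≃ ∑ (elements (⋃ (map A (elements T)))) weight

-- Only meaningful for non-empty S.
W-coefficient : ∀ {m} → SetFunction m → Subset m → ℝ
W-coefficient {m} f S =
  ∑ (filter (λ T → (S ∪ T) ≟ ⊤) (allSubsets m))
    (λ T → signed (∣ S ∩ T ∣ ℕ.+ 1) (f T))

-- A collection of subsets is a list; its size is the length of the list, so
-- the list is to be taken without repetitions.
IsNonCoverageCertificate : ∀ {m} → SetFunction m → List (Subset m) → Set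
IsNonCoverageCertificate {m} g 𝒥 =
  ¬ (∃ λ (f : SetFunction m) → IsCoverage f × (∀ T → T ∈ˡ 𝒥 → f T ≃ g T))

{-# OPTIONS --safe #-}
module Submission where

-- Suppose ∣𝒥∣ < 2^k.  It suffices to find an integer perturbation D of the
-- W-coefficients w such that the sum of D over the sets S meeting T vanishes
-- for T ∈ 𝒥, D ≥ 1 on the sets of size > k, and D ≥ -(2^m)! everywhere: then
-- w + D ≥ 0, and the coverage function with these W-coefficients agrees with
-- f* on 𝒥.
--
-- If ∣S₀∣ > k, fewer than 2^∣S₀∣ subsets of S₀ are of the form T ∩ S₀ with
-- T ∈ 𝒥 ∪ {∅}; choose R ⊆ S₀ not of this form.  The function
-- ripple S = (-1)^∣S₀∖S∣ [S₀∖R ⊆ S ⊆ S₀] has sum ±[T ∩ S₀ = R] over the sets S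
-- disjoint from T, so its sums over the S meeting T vanish for T ∈ 𝒥.  D is
-- the combination of these ripples with coefficients cost S₀ = 2^(Σ_{i∉S₀} 2^i).
-- This cost exceeds the total cost of all proper supersets of S₀, so the
-- ripples of larger sets cannot cancel the value 1 that S₀'s own ripple takes
-- at S₀, and it is at most (2^m)!.

open import Defs
open import Algebra.Bundles using (AbelianGroup; CommutativeMonoid)
import Algebra.Properties.AbelianGroup as AbelianGroupProperties
import Algebra.Properties.CommutativeSemigroup as CommutativeSemigroupProperties
open import Data.Bool.Base using (Bool; true; false; not; if_then_else_; _∧_; _∨_)
open import Data.Bool.Properties as Boolₚ using ()
open import Data.Fin.Base using (Fin; zero; suc)
open import Data.Fin.Subset using (Subset; Nonempty; ∣_∣; ⊥)
open import Data.Fin.Subset using (Side; inside; outside; ⊤; _∈_; _∩_; _∪_; ⋃)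
open import Data.Fin.Subset.Properties using (x∈p∪q⁺; x∈p∪q⁻; ∉⊥; _∈?_)
open import Data.Integer.Base as ℤ using (ℤ; +_; -1ℤ)
open import Data.Integer.Base using (-[1+_]; 0ℤ; 1ℤ; +≤+)
open import Data.Integer.Properties as ℤₚ using ()
open import Data.List.Base using (List; length)
open import Data.List.Base using ([]; _∷_; _++_; map; filter; foldr; lookup; allFin)
open import Data.List.Membership.Propositional using () renaming (_∈_ to _∈ˡ_)
open import Data.List.Membership.Propositional.Properties
  using (∈-allFin; ∈-filter⁺; ∈-filter⁻; ∈-map⁺; ∈-map⁻)
open import Data.List.Properties
  using (foldr-cong; foldr-map; length-map; map-tabulate; tabulate-lookup)
open import Data.List.Relation.Unary.Any using (here; there)
open import Data.List.Relation.Unary.Unique.Propositional using (Unique)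
open import Data.Nat.Base as ℕ using (ℕ; _^_; _!)
open import Data.Nat.Base using (zero; suc; z≤n; s≤s)
import Data.Nat.Coprimality as Coprime
open import Data.Nat.Properties as ℕₚ using ()
open import Data.Product.Base using (∃; _×_; _,_; proj₂)
open import Data.Rational.Base as ℚ using (0ℚ; ½; mkℚ)
open import Data.Rational.Properties as ℚₚ using ()
open import Data.Sum.Base using (_⊎_; inj₁; inj₂)
open import Data.Vec.Base as Vec using ([]; _∷_)
open import Data.Vec.Properties using (∷-injectiveʳ; lookup⇒[]=; []=⇒lookup; lookup∘tabulate)
open import Function.Base using (_∘_; const)
open import Relation.Binary.PropositionalEquality
  using (_≡_; _≢_; refl; sym; trans; cong; cong₂; subst; subst₂; module ≡-Reasoning)
import Relation.Binary.Reasoning.Setoid as SetoidReasoning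
open import Relation.Nullary using (does; yes; no; contradiction)
open import Relation.Nullary.Decidable using (dec-true; dec-false)
open import Relation.Unary using (Decidable)

-- Intersecting subsets and the set system of the coverage function

meets : ∀ {m} → Subset m → Subset m → Bool
meets []      []      = false
meets (s ∷ S) (t ∷ T) = (s ∧ t) ∨ meets S T

meets-⊥ : ∀ {m} (S : Subset m) → meets S ⊥ ≡ false
meets-⊥ []            = refl
meets-⊥ (inside  ∷ S) = meets-⊥ S
meets-⊥ (outside ∷ S) = meets-⊥ S

meets⁺ : ∀ {m} {S T : Subset m} {i} → i ∈ S → i ∈ T → meets S T ≡ true
meets⁺ Vec.here Vec.here = refl
meets⁺ {S = s ∷ S} {T = t ∷ T} (Vec.there i∈S) (Vec.there i∈T) with s ∧ t
... | true  = refl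
... | false = meets⁺ i∈S i∈T

meets⁻ : ∀ {m} (S T : Subset m) → meets S T ≡ true → ∃ λ i → i ∈ S × i ∈ T
meets⁻ []            []            ()
meets⁻ (inside  ∷ S) (inside  ∷ T) _ = zero , Vec.here , Vec.here
meets⁻ (inside  ∷ S) (outside ∷ T) eq =
  let i , i∈S , i∈T = meets⁻ S T eq in suc i , Vec.there i∈S , Vec.there i∈T
meets⁻ (outside ∷ S) (t       ∷ T) eq =
  let i , i∈S , i∈T = meets⁻ S T eq in suc i , Vec.there i∈S , Vec.there i∈T

∈-⋃⁺ : ∀ {n} {u : Fin n} {X} {Xs} → X ∈ˡ Xs → u ∈ X → u ∈ ⋃ Xs
∈-⋃⁺ (here refl) u∈X = x∈p∪q⁺ (inj₁ u∈X)
∈-⋃⁺ (there X∈)  u∈X = x∈p∪q⁺ (inj₂ (∈-⋃⁺ X∈ u∈X))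

∈-⋃⁻ : ∀ {n} {u : Fin n} Xs → u ∈ ⋃ Xs → ∃ λ X → X ∈ˡ Xs × u ∈ X
∈-⋃⁻ []       u∈ = contradiction u∈ ∉⊥
∈-⋃⁻ (X ∷ Xs) u∈ with x∈p∪q⁻ X (⋃ Xs) u∈
... | inj₁ u∈X = X , here refl , u∈X
... | inj₂ u∈⋃ = let Y , Y∈ , u∈Y = ∈-⋃⁻ Xs u∈⋃ in Y , there Y∈ , u∈Y

incidence : ∀ {m} (L : List (Subset m)) → Fin m → Subset (length L)
incidence L i = Vec.tabulate λ u → Vec.lookup (lookup L u) i

-- Position `u` lies in the union iff it lies in `incidence L i` for some i ∈ T, that is, iff the
-- subset listed at `u` contains some i ∈ T. The form is an equation of Booleans so that it rewrites
-- the condition left behind by `listSum-filter`.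
does-∈-⋃-incidence : ∀ {m} (L : List (Subset m)) T u →
  does (u ∈? ⋃ (map (incidence L) (elements T))) ≡ meets (lookup L u) T
does-∈-⋃-incidence L T u with meets (lookup L u) T in eq
... | true  = dec-true (u ∈? ⋃ (map (incidence L) (elements T)))
  (let i , i∈S , i∈T = meets⁻ (lookup L u) T eq in
   ∈-⋃⁺ (∈-map⁺ (incidence L) (∈-filter⁺ (_∈? T) (∈-allFin i) i∈T))
        (lookup⇒[]= u (incidence L i) (trans (lookup∘tabulate _ u) ([]=⇒lookup i∈S))))
... | false = dec-false (u ∈? ⋃ (map (incidence L) (elements T))) λ u∈ →
  let X , X∈ , u∈X = ∈-⋃⁻ (map (incidence L) (elements T)) u∈
      i , i∈ , X≡  = ∈-map⁻ (incidence L) X∈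
      i∈S = lookup⇒[]= i (lookup L u)
        (trans (sym (lookup∘tabulate _ u)) ([]=⇒lookup (subst (u ∈_) X≡ u∈X)))
      i∈T = proj₂ (∈-filter⁻ (_∈? T) {xs = allFin _} i∈)
  in contradiction (trans (sym eq) (meets⁺ i∈S i∈T)) λ ()

-- Sums over families of subsets

module SubsetSum {c ℓ} (M : CommutativeMonoid c ℓ) where
  open CommutativeMonoid M renaming (refl to ≈-refl; sym to ≈-sym; trans to ≈-trans)
  open CommutativeSemigroupProperties commutativeSemigroup using (interchange)

  -- The recursion mirrors `allSubsets`. The condition is Boolean so that, once the first
  -- coordinates are fixed, conditions such as `not (meets S T)` compute; where they are forced to
  -- fail they become `const false`.
  sum : ∀ {m} → (Subset m → Bool) → (Subset m → Carrier) → Carrier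
  sum {zero}  b φ = if b [] then φ [] else ε
  sum {suc m} b φ =
    sum (b ∘ (outside ∷_)) (φ ∘ (outside ∷_)) ∙ sum (b ∘ (inside ∷_)) (φ ∘ (inside ∷_))

  -- The summands are compared only where the condition holds, because W-coefficients are prescribed
  -- only for non-empty sets.
  sum-cong : ∀ {m} {b b′ : Subset m → Bool} {φ ψ : Subset m → Carrier} →
    (∀ S → b S ≡ b′ S) → (∀ S → b S ≡ true → φ S ≈ ψ S) → sum b φ ≈ sum b′ ψ
  sum-cong {zero} {b} {b′} b≡b′ φ≈ψ with b [] in eq | b′ [] | b≡b′ []
  ... | true  | true  | refl = φ≈ψ [] eq
  ... | false | false | refl = ≈-refl
  sum-cong {suc m} b≡b′ φ≈ψ =
    ∙-cong (sum-cong (b≡b′ ∘ (outside ∷_)) (φ≈ψ ∘ (outside ∷_)))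
           (sum-cong (b≡b′ ∘ (inside ∷_)) (φ≈ψ ∘ (inside ∷_)))

  sum-congʳ : ∀ {m} (b : Subset m → Bool) {φ ψ : Subset m → Carrier} →
    (∀ S → φ S ≈ ψ S) → sum b φ ≈ sum b ψ
  sum-congʳ b φ≈ψ = sum-cong {b = b} (λ _ → refl) (λ S _ → φ≈ψ S)

  sum-ε : ∀ {m} (b : Subset m → Bool) → sum b (const ε) ≈ ε
  sum-ε {zero} b with b []
  ... | true  = ≈-refl
  ... | false = ≈-refl
  sum-ε {suc m} b = ≈-trans
    (∙-cong (sum-ε (b ∘ (outside ∷_))) (sum-ε (b ∘ (inside ∷_)))) (identityˡ ε)

  sum-none : ∀ {m} (φ : Subset m → Carrier) → sum (const false) φ ≈ ε
  sum-none {zero}  φ = ≈-refl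
  sum-none {suc m} φ = ≈-trans
    (∙-cong (sum-none (φ ∘ (outside ∷_))) (sum-none (φ ∘ (inside ∷_)))) (identityˡ ε)

  sum-∙ : ∀ {m} (b : Subset m → Bool) (φ ψ : Subset m → Carrier) →
    sum b (λ S → φ S ∙ ψ S) ≈ sum b φ ∙ sum b ψ
  sum-∙ {zero} b φ ψ with b []
  ... | true  = ≈-refl
  ... | false = ≈-sym (identityˡ ε)
  sum-∙ {suc m} b φ ψ = ≈-trans
    (∙-cong (sum-∙ (b ∘ (outside ∷_)) _ _) (sum-∙ (b ∘ (inside ∷_)) _ _))
    (interchange _ _ _ _)

  sum-complement : ∀ {m} (b : Subset m → Bool) (φ : Subset m → Carrier) →
    sum b φ ∙ sum (not ∘ b) φ ≈ sum (const true) φ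
  sum-complement {zero} b φ with b []
  ... | true  = identityʳ (φ [])
  ... | false = identityˡ (φ [])
  sum-complement {suc m} b φ = ≈-trans (interchange _ _ _ _)
    (∙-cong (sum-complement (b ∘ (outside ∷_)) _) (sum-complement (b ∘ (inside ∷_)) _))

  sum-swap : ∀ {m n} (b : Subset m → Bool) (b′ : Subset n → Bool)
    (F : Subset n → Subset m → Carrier) →
    sum b (λ S → sum b′ (λ R → F R S)) ≈ sum b′ (λ R → sum b (F R))
  sum-swap {n = zero} b b′ F with b′ []
  ... | true  = ≈-refl
  ... | false = sum-ε b
  sum-swap {n = suc n} b b′ F = ≈-trans (sum-∙ b _ _)
    (∙-cong (sum-swap b (b′ ∘ (outside ∷_)) (F ∘ (outside ∷_)))
            (sum-swap b (b′ ∘ (inside ∷_)) (F ∘ (inside ∷_))))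

  -- Every set avoids `⊥`, so the right-hand side is the sum over all subsets. In this form,
  -- information about avoiding sums alone, at `T` and at `⊥`, determines the meeting sum.
  sum-meeting-avoiding : ∀ {m} (φ : Subset m → Carrier) T →
    sum (λ S → meets S T) φ ∙ sum (λ S → not (meets S T)) φ ≈ sum (λ S → not (meets S ⊥)) φ
  sum-meeting-avoiding φ T = ≈-trans (sum-complement (λ S → meets S T) φ)
    (sum-cong {φ = φ} {ψ = φ} (λ S → cong not (sym (meets-⊥ S))) (λ _ _ → ≈-refl))

  listSum : {A : Set} → List A → (A → Carrier) → Carrier
  listSum xs f = foldr (λ a s → f a ∙ s) ε xs

  listSum-filter : ∀ {A : Set} {P : A → Set} (P? : Decidable P) xs (φ : A → Carrier) →
    listSum (filter P? xs) φ ≈ listSum xs (λ x → if does (P? x) then φ x else ε)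
  listSum-filter P? []       φ = ≈-refl
  listSum-filter P? (x ∷ xs) φ with does (P? x)
  ... | true  = ∙-congˡ (listSum-filter P? xs φ)
  ... | false = ≈-trans (listSum-filter P? xs φ) (≈-sym (identityˡ _))

  listSum-++ : ∀ {A : Set} (xs ys : List A) (φ : A → Carrier) →
    listSum (xs ++ ys) φ ≈ listSum xs φ ∙ listSum ys φ
  listSum-++ []       ys φ = ≈-sym (identityˡ _)
  listSum-++ (x ∷ xs) ys φ = ≈-trans (∙-congˡ (listSum-++ xs ys φ)) (≈-sym (assoc _ _ _))

  listSum-map : ∀ {A B : Set} (g : A → B) xs (φ : B → Carrier) →
    listSum (map g xs) φ ≡ listSum xs (φ ∘ g)
  listSum-map g xs φ = foldr-map _ g _ xs

  listSum-allSubsets : ∀ {m} (b : Subset m → Bool) (φ : Subset m → Carrier) →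
    listSum (allSubsets m) (λ S → if b S then φ S else ε) ≈ sum b φ
  listSum-allSubsets {zero}  b φ = identityʳ _
  listSum-allSubsets {suc m} b φ = ≈-trans
    (listSum-++ (map (outside ∷_) (allSubsets m)) (map (inside ∷_) (allSubsets m)) _)
    (∙-cong
      (≈-trans (reflexive (listSum-map (outside ∷_) (allSubsets m) _))
               (listSum-allSubsets (b ∘ (outside ∷_)) (φ ∘ (outside ∷_))))
      (≈-trans (reflexive (listSum-map (inside ∷_) (allSubsets m) _))
               (listSum-allSubsets (b ∘ (inside ∷_)) (φ ∘ (inside ∷_)))))

  -- Over the universe of all subsets, where i covers the sets containing it, weights φ give a
  -- covered weight whose W-coefficients are φ. Hence any non-negative W-coefficients can be
  -- realised.
  listSum-covered : ∀ {m} (φ : Subset m → Carrier) T →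
    listSum (elements (⋃ (map (incidence (allSubsets m)) (elements T)))) (φ ∘ lookup (allSubsets m))
      ≈ sum (λ S → meets S T) φ
  listSum-covered {m} φ T = begin
    listSum (elements X) (φ ∘ lookup L)
      ≈⟨ listSum-filter (_∈? X) (allFin (length L)) (φ ∘ lookup L) ⟩
    listSum (allFin (length L)) (λ u → if does (u ∈? X) then φ (lookup L u) else ε)
      ≡⟨ listSum-cong (allFin (length L)) (λ u →
           cong (λ b → if b then φ (lookup L u) else ε) (does-∈-⋃-incidence L T u)) ⟩
    listSum (allFin (length L)) (ψ ∘ lookup L)
      ≡⟨ listSum-map (lookup L) (allFin (length L)) ψ ⟨
    listSum (map (lookup L) (allFin (length L))) ψ
      ≡⟨ cong (λ Ss → listSum Ss ψ) (trans (map-tabulate (λ u → u) (lookup L)) (tabulate-lookup L)) ⟩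
    listSum L ψ
      ≈⟨ listSum-allSubsets (λ S → meets S T) φ ⟩
    sum (λ S → meets S T) φ ∎
    where
    open SetoidReasoning setoid
    L = allSubsets m
    X = ⋃ (map (incidence L) (elements T))
    ψ = λ S → if meets S T then φ S else ε
    listSum-cong : ∀ {A : Set} (xs : List A) {f g : A → Carrier} →
      (∀ x → f x ≡ g x) → listSum xs f ≡ listSum xs g
    listSum-cong xs f≡g = foldr-cong (λ x s → cong (_∙ s) (f≡g x)) refl xs

module SubsetSumHomomorphism {c ℓ c′ ℓ′}
  (M : CommutativeMonoid c ℓ) (M′ : CommutativeMonoid c′ ℓ′)
  (h : CommutativeMonoid.Carrier M → CommutativeMonoid.Carrier M′)
  (h-ε : CommutativeMonoid._≈_ M′ (h (CommutativeMonoid.ε M)) (CommutativeMonoid.ε M′))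
  (h-∙ : ∀ x y → CommutativeMonoid._≈_ M′
    (h (CommutativeMonoid._∙_ M x y)) (CommutativeMonoid._∙_ M′ (h x) (h y)))
  where
  private
    module M′ = CommutativeMonoid M′
    module Σ  = SubsetSum M
    module Σ′ = SubsetSum M′

  -- Used for inversion in a group, for multiplication by a constant, and for the embeddings between
  -- ℕ, ℤ and ℝ.
  sum-homo : ∀ {m} (b : Subset m → Bool) φ → h (Σ.sum b φ) M′.≈ Σ′.sum b (h ∘ φ)
  sum-homo {zero} b φ with b []
  ... | true  = M′.refl
  ... | false = h-ε
  sum-homo {suc m} b φ = M′.trans (h-∙ _ _)
    (M′.∙-cong (sum-homo (b ∘ (outside ∷_)) (φ ∘ (outside ∷_)))
               (sum-homo (b ∘ (inside ∷_)) (φ ∘ (inside ∷_))))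

module ℕΣ = SubsetSum ℕₚ.+-0-commutativeMonoid
module ℤΣ = SubsetSum ℤₚ.+-0-commutativeMonoid

-- A trace missed by a short list

section : ∀ {n} → Side → List (Subset (suc n)) → List (Subset n)
section s       []                  = []
section inside  ((inside  ∷ T) ∷ L) = T ∷ section inside L
section inside  ((outside ∷ T) ∷ L) = section inside L
section outside ((inside  ∷ T) ∷ L) = section outside L
section outside ((outside ∷ T) ∷ L) = T ∷ section outside L

length-section : ∀ {n} (L : List (Subset (suc n))) →
  length (section inside L) ℕ.+ length (section outside L) ≡ length L
length-section []                  = refl
length-section ((inside  ∷ T) ∷ L) = cong suc (length-section L)
length-section ((outside ∷ T) ∷ L) =
  trans (ℕₚ.+-suc (length (section inside L)) (length (section outside L)))
        (cong suc (length-section L))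

∈-section : ∀ {n} s {T : Subset n} {L} → (s ∷ T) ∈ˡ L → T ∈ˡ section s L
∈-section inside  {L = (inside  ∷ T) ∷ L} (here refl) = here refl
∈-section inside  {L = (inside  ∷ T) ∷ L} (there p)   = there (∈-section inside p)
∈-section inside  {L = (outside ∷ T) ∷ L} (there p)   = ∈-section inside p
∈-section outside {L = (inside  ∷ T) ∷ L} (there p)   = ∈-section outside p
∈-section outside {L = (outside ∷ T) ∷ L} (here refl) = here refl
∈-section outside {L = (outside ∷ T) ∷ L} (there p)   = there (∈-section outside p)

-- Induction on the coordinates. Outside `P` a coordinate does not affect traces and is dropped. At
-- a coordinate of `P` the list splits into two sections of total length below 2 · 2^∣P∣ (`P` now
-- being the tail), so one section is shorter than 2^∣P∣; a trace missed there, extended by the bit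
-- of that section, is missed by the whole list.
missing-trace : ∀ {n} (P : Subset n) (L : List (Subset n)) → length L ℕ.< 2 ^ ∣ P ∣ →
  ∃ λ R → ∀ T → T ∈ˡ L → T ∩ P ≢ R ∩ P
missing-trace []            []      _         = [] , λ _ ()
missing-trace []            (_ ∷ _) (s≤s ())
missing-trace (outside ∷ P) L       L<
  with missing-trace P (map Vec.tail L) (subst (ℕ._< 2 ^ ∣ P ∣) (sym (length-map Vec.tail L)) L<)
... | R , R∉ = outside ∷ R , λ where
        (_ ∷ T) T∈L eq → R∉ T (∈-map⁺ Vec.tail T∈L) (∷-injectiveʳ eq)
missing-trace (inside ∷ P) L L< with length (section inside L) ℕₚ.<? 2 ^ ∣ P ∣
... | yes L₁< with missing-trace P (section inside L) L₁<
...   | R , R∉ = inside ∷ R , λ where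
        (inside  ∷ T) T∈L eq → R∉ T (∈-section inside T∈L) (∷-injectiveʳ eq)
        (outside ∷ T) T∈L ()
missing-trace (inside ∷ P) L L< | no L₁≮
  with missing-trace P (section outside L) L₀<
  where
  open ℕₚ.≤-Reasoning
  L₀< : length (section outside L) ℕ.< 2 ^ ∣ P ∣
  L₀< = ℕₚ.+-cancelˡ-< (2 ^ ∣ P ∣) _ _ (begin-strict
    2 ^ ∣ P ∣ ℕ.+ length (section outside L)
      ≤⟨ ℕₚ.+-monoˡ-≤ _ (ℕₚ.≮⇒≥ L₁≮) ⟩
    length (section inside L) ℕ.+ length (section outside L)
      ≡⟨ length-section L ⟩
    length L
      <⟨ L< ⟩
    2 ℕ.* 2 ^ ∣ P ∣
      ≡⟨ cong (ℕ._+_ (2 ^ ∣ P ∣)) (ℕₚ.+-identityʳ (2 ^ ∣ P ∣)) ⟩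
    2 ^ ∣ P ∣ ℕ.+ 2 ^ ∣ P ∣ ∎)
... | R , R∉ = outside ∷ R , λ where
        (inside  ∷ T) T∈L ()
        (outside ∷ T) T∈L eq → R∉ T (∈-section outside T∈L) (∷-injectiveʳ eq)

-- Ripples and their sums over disjoint sets

-- (-1)^∣S₀∖S∣ if S₀∖R ⊆ S ⊆ S₀, and 0 otherwise.
ripple : ∀ {m} → Subset m → Subset m → Subset m → ℤ
ripple []            []             []            = 1ℤ
ripple (_ ∷ R)       (outside ∷ S₀) (outside ∷ S) = ripple R S₀ S
ripple (_ ∷ R)       (outside ∷ S₀) (inside  ∷ S) = 0ℤ
ripple (_ ∷ R)       (inside  ∷ S₀) (inside  ∷ S) = ripple R S₀ S
ripple (inside ∷ R)  (inside  ∷ S₀) (outside ∷ S) = ℤ.- ripple R S₀ S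
ripple (outside ∷ R) (inside  ∷ S₀) (outside ∷ S) = 0ℤ

ripple-diagonal : ∀ {m} (R S₀ : Subset m) → ripple R S₀ S₀ ≡ 1ℤ
ripple-diagonal []      []             = refl
ripple-diagonal (r ∷ R) (outside ∷ S₀) = ripple-diagonal R S₀
ripple-diagonal (r ∷ R) (inside  ∷ S₀) = ripple-diagonal R S₀

module ℤΣ-neg = SubsetSumHomomorphism ℤₚ.+-0-commutativeMonoid ℤₚ.+-0-commutativeMonoid
  (ℤ.-_) refl ℤₚ.neg-distrib-+

-- The ripple is a product over coordinates, so its sum over the S disjoint from `T` is one too. At
-- a coordinate of `S₀` lying in exactly one of `R` and `T` the factor is 0: in `R` only, the values
-- 1 and -1 cancel; in `T` only, S must leave the coordinate out, where the ripple vanishes.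
sum-avoiding-ripple : ∀ {m} (R S₀ T : Subset m) → T ∩ S₀ ≢ R ∩ S₀ →
  ℤΣ.sum (λ S → not (meets S T)) (ripple R S₀) ≡ 0ℤ
sum-avoiding-ripple []      []             []            ≢ = contradiction refl ≢
sum-avoiding-ripple (r ∷ R) (outside ∷ S₀) (t ∷ T) ≢ = cong₂ ℤ._+_
  (sum-avoiding-ripple R S₀ T λ eq →
    ≢ (cong₂ _∷_ (trans (Boolₚ.∧-zeroʳ t) (sym (Boolₚ.∧-zeroʳ r))) eq))
  (ℤΣ.sum-ε (λ S → not (t ∨ meets S T)))
sum-avoiding-ripple (inside ∷ R) (inside ∷ S₀) (inside ∷ T) ≢ = cong₂ ℤ._+_
  (trans (sym (ℤΣ-neg.sum-homo _ (ripple R S₀)))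
    (cong (ℤ.-_) (sum-avoiding-ripple R S₀ T (≢ ∘ cong (inside ∷_)))))
  (ℤΣ.sum-none (ripple R S₀))
sum-avoiding-ripple (outside ∷ R) (inside ∷ S₀) (inside ∷ T) ≢ = cong₂ ℤ._+_
  (ℤΣ.sum-ε (λ S → not (meets S T))) (ℤΣ.sum-none (ripple R S₀))
sum-avoiding-ripple (inside ∷ R) (inside ∷ S₀) (outside ∷ T) ≢ = trans
  (cong (ℤ._+ σ) (sym (ℤΣ-neg.sum-homo (λ S → not (meets S T)) (ripple R S₀))))
  (ℤₚ.+-inverseˡ σ)
  where σ = ℤΣ.sum (λ S → not (meets S T)) (ripple R S₀)
sum-avoiding-ripple (outside ∷ R) (inside ∷ S₀) (outside ∷ T) ≢ = cong₂ ℤ._+_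
  (ℤΣ.sum-ε (λ S → not (meets S T)))
  (sum-avoiding-ripple R S₀ T (≢ ∘ cong (outside ∷_)))

-- Costs of sets

-- 2^(Σ_{i∉S} 2^i), where i is the number of coordinates following it.
cost : ∀ {m} → Subset m → ℕ
cost         []            = 1
cost         (inside  ∷ S) = cost S
cost {suc m} (outside ∷ S) = 2 ^ 2 ^ m ℕ.* cost S

-- cost S₀ if S ⊆ S₀, and 0 otherwise.
supersetCost : ∀ {m} → Subset m → Subset m → ℕ
supersetCost         []            []             = 1
supersetCost         (s       ∷ S) (inside  ∷ S₀) = supersetCost S S₀
supersetCost         (inside  ∷ S) (outside ∷ S₀) = 0
supersetCost {suc m} (outside ∷ S) (outside ∷ S₀) = 2 ^ 2 ^ m ℕ.* supersetCost S S₀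

supersetCost-diagonal : ∀ {m} (S : Subset m) → supersetCost S S ≡ cost S
supersetCost-diagonal []            = refl
supersetCost-diagonal (inside  ∷ S) = supersetCost-diagonal S
supersetCost-diagonal {suc m} (outside ∷ S) = cong (2 ^ 2 ^ m ℕ.*_) (supersetCost-diagonal S)

-- A ripple takes values in -1, 0, 1 and vanishes unless S ⊆ S₀. The bound no longer depends on `R`,
-- which is known only to exist.
cost*∣ripple∣≤ : ∀ {m} (R S₀ S : Subset m) →
  cost S₀ ℕ.* ℤ.∣ ripple R S₀ S ∣ ℕ.≤ supersetCost S S₀
cost*∣ripple∣≤ [] [] [] = ℕₚ.≤-refl
cost*∣ripple∣≤ {suc m} (r ∷ R) (outside ∷ S₀) (outside ∷ S) = ℕₚ.≤-trans
  (ℕₚ.≤-reflexive (ℕₚ.*-assoc (2 ^ 2 ^ m) (cost S₀) _))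
  (ℕₚ.*-monoʳ-≤ (2 ^ 2 ^ m) (cost*∣ripple∣≤ R S₀ S))
cost*∣ripple∣≤ {suc m} (r ∷ R) (outside ∷ S₀) (inside ∷ S) =
  ℕₚ.≤-reflexive (ℕₚ.*-zeroʳ (2 ^ 2 ^ m ℕ.* cost S₀))
cost*∣ripple∣≤ (r ∷ R) (inside ∷ S₀) (inside ∷ S) = cost*∣ripple∣≤ R S₀ S
cost*∣ripple∣≤ (inside ∷ R) (inside ∷ S₀) (outside ∷ S) = ℕₚ.≤-trans
  (ℕₚ.≤-reflexive (cong (cost S₀ ℕ.*_) (ℤₚ.∣-i∣≡∣i∣ (ripple R S₀ S))))
  (cost*∣ripple∣≤ R S₀ S)
cost*∣ripple∣≤ (outside ∷ R) (inside ∷ S₀) (outside ∷ S) =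
  ℕₚ.≤-trans (ℕₚ.≤-reflexive (ℕₚ.*-zeroʳ (cost S₀))) z≤n

2^2^suc : ∀ m → 2 ^ 2 ^ suc m ≡ 2 ^ 2 ^ m ℕ.* 2 ^ 2 ^ m
2^2^suc m = trans (cong (λ i → 2 ^ (2 ^ m ℕ.+ i)) (ℕₚ.+-identityʳ (2 ^ m)))
  (ℕₚ.^-distribˡ-+-* 2 (2 ^ m) (2 ^ m))

-- The exponent of the cost is a sum of distinct powers 2^i with i < m, hence at most 2^m - 1.
2*cost≤2^2^ : ∀ {m} (S : Subset m) → 2 ℕ.* cost S ℕ.≤ 2 ^ 2 ^ m
2*cost≤2^2^ [] = ℕₚ.≤-refl
2*cost≤2^2^ {suc m} (inside ∷ S) = ℕₚ.≤-trans (2*cost≤2^2^ S)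
  (ℕₚ.^-monoʳ-≤ 2 (ℕₚ.m≤m+n (2 ^ m) _))
2*cost≤2^2^ {suc m} (outside ∷ S) = begin
  2 ℕ.* (K ℕ.* cost S)  ≡⟨ x∙yz≈y∙xz 2 K (cost S) ⟩
  K ℕ.* (2 ℕ.* cost S)  ≤⟨ ℕₚ.*-monoʳ-≤ K (2*cost≤2^2^ S) ⟩
  K ℕ.* K               ≡⟨ 2^2^suc m ⟨
  2 ^ 2 ^ suc m         ∎
  where
  open ℕₚ.≤-Reasoning
  open CommutativeSemigroupProperties ℕₚ.*-commutativeSemigroup using (x∙yz≈y∙xz)
  K = 2 ^ 2 ^ m

-- The exponent of a cost encodes the complement in binary, so the costs of the supersets of S are
-- distinct powers of two, the largest being `cost S`; their sum is below twice the largest.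
sum-supersetCost< : ∀ {m} (S : Subset m) →
  ℕΣ.sum (const true) (supersetCost S) ℕ.< 2 ℕ.* cost S
sum-supersetCost< [] = s≤s (s≤s z≤n)
sum-supersetCost< {suc m} (inside ∷ S) = subst (ℕ._< 2 ℕ.* cost S)
  (sym (cong (ℕ._+ ℕΣ.sum (const true) (supersetCost S)) (ℕΣ.sum-ε {m} (const true))))
  (sum-supersetCost< S)
sum-supersetCost< {suc m} (outside ∷ S) = begin-strict
  ℕΣ.sum (const true) (λ S₀ → K ℕ.* supersetCost S S₀) ℕ.+ v
    ≡⟨ cong (ℕ._+ v) (Scaling.sum-homo (const true) (supersetCost S)) ⟨
  K ℕ.* v ℕ.+ v
    -- The induction hypothesis enters twice: here as v < 2 · cost S ≤ K, and below as suc v ≤ 2 ·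
    -- cost S.
    <⟨ ℕₚ.+-monoʳ-< (K ℕ.* v) (ℕₚ.<-≤-trans (sum-supersetCost< S) (2*cost≤2^2^ S)) ⟩
  K ℕ.* v ℕ.+ K
    ≡⟨ ℕₚ.+-comm (K ℕ.* v) K ⟩
  K ℕ.+ K ℕ.* v
    ≡⟨ ℕₚ.*-suc K v ⟨
  K ℕ.* suc v
    ≤⟨ ℕₚ.*-monoʳ-≤ K (sum-supersetCost< S) ⟩
  K ℕ.* (2 ℕ.* cost S)
    ≡⟨ x∙yz≈y∙xz K 2 (cost S) ⟩
  2 ℕ.* (K ℕ.* cost S) ∎
  where
  open ℕₚ.≤-Reasoning
  open CommutativeSemigroupProperties ℕₚ.*-commutativeSemigroup using (x∙yz≈y∙xz)
  K = 2 ^ 2 ^ m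
  v = ℕΣ.sum (const true) (supersetCost S)
  module Scaling = SubsetSumHomomorphism ℕₚ.+-0-commutativeMonoid ℕₚ.+-0-commutativeMonoid
    (K ℕ.*_) (ℕₚ.*-zeroʳ K) (ℕₚ.*-distribˡ-+ K)

-- Each of the factors 2, ..., n of the factorial is at least 2.
2^n≤2*n! : ∀ n → 2 ^ n ℕ.≤ 2 ℕ.* n !
2^n≤2*n! zero          = s≤s z≤n
2^n≤2*n! (suc zero)    = ℕₚ.≤-refl
2^n≤2*n! (suc (suc n)) = ℕₚ.*-monoʳ-≤ 2
  (ℕₚ.≤-trans (2^n≤2*n! (suc n)) (ℕₚ.*-monoˡ-≤ (suc n !) {2} {suc (suc n)} (s≤s (s≤s z≤n))))

-- The origin of the bound (2^m)! on `N`: twice the cost is at most 2^(2^m), which is at most twice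
-- this factorial.
cost≤2^! : ∀ {m} (S : Subset m) → cost S ℕ.≤ (2 ^ m) !
cost≤2^! {m} S = ℕₚ.*-cancelˡ-≤ 2 (ℕₚ.≤-trans (2*cost≤2^2^ S) (2^n≤2*n! (2 ^ m)))

-- The integer perturbation

sum-nonneg : ∀ {m} (b : Subset m → Bool) (φ : Subset m → ℤ) →
  (∀ S → 0ℤ ℤ.≤ φ S) → 0ℤ ℤ.≤ ℤΣ.sum b φ
sum-nonneg {zero} b φ 0≤φ with b []
... | true  = 0≤φ []
... | false = ℤₚ.≤-refl
sum-nonneg {suc m} b φ 0≤φ = ℤₚ.+-mono-≤
  (sum-nonneg (b ∘ (outside ∷_)) (φ ∘ (outside ∷_)) (0≤φ ∘ (outside ∷_)))
  (sum-nonneg (b ∘ (inside ∷_)) (φ ∘ (inside ∷_)) (0≤φ ∘ (inside ∷_)))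

term≤sum : ∀ {m} (φ : Subset m → ℤ) →
  (∀ S → 0ℤ ℤ.≤ φ S) → ∀ S → φ S ℤ.≤ ℤΣ.sum (const true) φ
term≤sum φ 0≤φ [] = ℤₚ.≤-refl
term≤sum φ 0≤φ (outside ∷ S) = subst (ℤ._≤ ℤΣ.sum (const true) φ) (ℤₚ.+-identityʳ _)
  (ℤₚ.+-mono-≤ (term≤sum (φ ∘ (outside ∷_)) (0≤φ ∘ (outside ∷_)) S)
               (sum-nonneg (const true) (φ ∘ (inside ∷_)) (0≤φ ∘ (inside ∷_))))
term≤sum φ 0≤φ (inside ∷ S) = subst (ℤ._≤ ℤΣ.sum (const true) φ) (ℤₚ.+-identityˡ _)
  (ℤₚ.+-mono-≤ (sum-nonneg (const true) (φ ∘ (outside ∷_)) (0≤φ ∘ (outside ∷_)))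
               (term≤sum (φ ∘ (inside ∷_)) (0≤φ ∘ (inside ∷_)) S))

0≤i+n : ∀ i n → ℤ.∣ i ∣ ℕ.≤ n → 0ℤ ℤ.≤ i ℤ.+ + n
0≤i+n (+ k)    n _ = +≤+ z≤n
0≤i+n -[1+ k ] n k<n = subst (0ℤ ℤ.≤_) (sym (ℤₚ.⊖-≥ k<n)) (+≤+ z≤n)

+-cancelʳ-≤ : ∀ {i j} l → i ℤ.+ l ℤ.≤ j ℤ.+ l → i ℤ.≤ j
+-cancelʳ-≤ {i} {j} l = subst₂ ℤ._≤_ (//-rightDividesʳ l i) (//-rightDividesʳ l j)
  ∘ ℤₚ.+-monoˡ-≤ (ℤ.- l)
  where open AbelianGroupProperties ℤₚ.+-0-abelianGroup using (//-rightDividesʳ)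

-- The contribution of one set `S₀`: a multiple of a ripple if ∣S₀∣ > k and zero otherwise.
-- `bounded` limits the harm done at every S, while `nonneg` and `large` record the gain at `S₀`
-- itself.
record LocalPerturbation {m} (k : ℕ) (L : List (Subset m)) (S₀ : Subset m) : Set where
  field
    δ       : Subset m → ℤ
    avoid≡0 : ∀ {T} → T ∈ˡ L → ℤΣ.sum (λ S → not (meets S T)) δ ≡ 0ℤ
    bounded : ∀ S → 0ℤ ℤ.≤ δ S ℤ.+ + supersetCost S S₀
    nonneg  : 0ℤ ℤ.≤ δ S₀
    large   : ∣ S₀ ∣ ℕ.> k → + cost S₀ ℤ.≤ δ S₀

localPerturbation : ∀ {m} k (L : List (Subset m)) → length L ℕ.< 2 ^ suc k →
  ∀ S₀ → LocalPerturbation k L S₀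
localPerturbation k L L< S₀ with k ℕₚ.<? ∣ S₀ ∣
... | no k≮ = record
  { δ       = const 0ℤ
  ; avoid≡0 = λ {T} _ → ℤΣ.sum-ε (λ S → not (meets S T))
  ; bounded = λ _ → +≤+ z≤n
  ; nonneg  = ℤₚ.≤-refl
  ; large   = λ k< → contradiction k< k≮ }
-- Here ∣S₀∣ ≥ k + 1, so the list is shorter than 2^∣S₀∣ and misses a trace on `S₀`.
... | yes k< with missing-trace S₀ L (ℕₚ.<-≤-trans L< (ℕₚ.^-monoʳ-≤ 2 k<))
...   | R , R∉ = record
  { δ       = λ S → + cost S₀ ℤ.* ripple R S₀ S
  ; avoid≡0 = λ {T} T∈L → trans (sym (Scaling.sum-homo (λ S → not (meets S T)) (ripple R S₀)))
      (trans (cong (+ cost S₀ ℤ.*_) (sum-avoiding-ripple R S₀ T (R∉ T T∈L)))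
             (ℤₚ.*-zeroʳ (+ cost S₀)))
  ; bounded = λ S → 0≤i+n (+ cost S₀ ℤ.* ripple R S₀ S) (supersetCost S S₀)
      (subst (ℕ._≤ supersetCost S S₀) (sym (ℤₚ.∣i*j∣≡∣i∣*∣j∣ (+ cost S₀) (ripple R S₀ S)))
        (cost*∣ripple∣≤ R S₀ S))
  ; nonneg  = subst (0ℤ ℤ.≤_) (sym diagonal) (+≤+ z≤n)
  ; large   = λ _ → ℤₚ.≤-reflexive (sym diagonal) }
  where
  diagonal : + cost S₀ ℤ.* ripple R S₀ S₀ ≡ + cost S₀
  diagonal = trans (cong (+ cost S₀ ℤ.*_) (ripple-diagonal R S₀)) (ℤₚ.*-identityʳ (+ cost S₀))
  module Scaling = SubsetSumHomomorphism ℤₚ.+-0-commutativeMonoid ℤₚ.+-0-commutativeMonoid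
    (+ cost S₀ ℤ.*_) (ℤₚ.*-zeroʳ (+ cost S₀)) (ℤₚ.*-distribˡ-+ (+ cost S₀))

module ℕ→ℤ = SubsetSumHomomorphism ℕₚ.+-0-commutativeMonoid ℤₚ.+-0-commutativeMonoid
  +_ refl ℤₚ.pos-+

module Perturbation {m} (k : ℕ) (L : List (Subset m)) (L< : length L ℕ.< 2 ^ suc k) where
  open LocalPerturbation

  local : ∀ S₀ → LocalPerturbation k L S₀
  local = localPerturbation k L L<

  perturbation : Subset m → ℤ
  perturbation S = ℤΣ.sum (const true) (λ S₀ → δ (local S₀) S)

  sum-avoiding-perturbation : ∀ {T} → T ∈ˡ L →
    ℤΣ.sum (λ S → not (meets S T)) perturbation ≡ 0ℤ
  sum-avoiding-perturbation {T} T∈L = trans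
    (ℤΣ.sum-swap (λ S → not (meets S T)) (const true) (λ S₀ → δ (local S₀)))
    (trans (ℤΣ.sum-congʳ (const true) (λ S₀ → avoid≡0 (local S₀) T∈L)) (ℤΣ.sum-ε {m} (const true)))

  -- By `bounded`, adding `supersetCost S S₀` makes the contribution of every `S₀` at S
  -- non-negative, so the single term S₀ = S is at most the whole sum.
  δ+cost≤ : ∀ S → δ (local S) S ℤ.+ + cost S ℤ.≤
    perturbation S ℤ.+ + ℕΣ.sum (const true) (supersetCost S)
  δ+cost≤ S = begin
    δ (local S) S ℤ.+ + cost S
      ≡⟨ cong (λ c → δ (local S) S ℤ.+ + c) (supersetCost-diagonal S) ⟨
    δ (local S) S ℤ.+ + supersetCost S S
      ≤⟨ term≤sum (λ S₀ → δ (local S₀) S ℤ.+ + supersetCost S S₀) (λ S₀ → bounded (local S₀) S) S ⟩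
    ℤΣ.sum (const true) (λ S₀ → δ (local S₀) S ℤ.+ + supersetCost S S₀)
      ≡⟨ ℤΣ.sum-∙ (const true) (λ S₀ → δ (local S₀) S) (+_ ∘ supersetCost S) ⟩
    perturbation S ℤ.+ ℤΣ.sum (const true) (+_ ∘ supersetCost S)
      ≡⟨ cong (λ i → perturbation S ℤ.+ i) (ℕ→ℤ.sum-homo (const true) (supersetCost S)) ⟨
    perturbation S ℤ.+ + ℕΣ.sum (const true) (supersetCost S) ∎
    where open ℤₚ.≤-Reasoning

  -- The supersets of S, S included, cost at most 2 · cost S - 1 in total. Subtracting one `cost S`
  -- from both sides of `δ+cost≤` leaves a gain of 1: a contribution of at least `cost S` gives a
  -- value of at least 1, and a non-negative one gives at least 1 - cost S.
  δ<perturbation+cost : ∀ S → 1ℤ ℤ.+ δ (local S) S ℤ.≤ perturbation S ℤ.+ + cost S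
  δ<perturbation+cost S = +-cancelʳ-≤ (+ cost S) (begin
    (1ℤ ℤ.+ δ (local S) S) ℤ.+ c
      ≡⟨ ℤₚ.+-assoc 1ℤ (δ (local S) S) c ⟩
    1ℤ ℤ.+ (δ (local S) S ℤ.+ c)
      ≤⟨ ℤₚ.+-monoʳ-≤ 1ℤ (δ+cost≤ S) ⟩
    1ℤ ℤ.+ (perturbation S ℤ.+ + v)
      ≡⟨ x∙yz≈y∙xz 1ℤ (perturbation S) (+ v) ⟩
    perturbation S ℤ.+ + suc v
      ≤⟨ ℤₚ.+-monoʳ-≤ (perturbation S) (+≤+ (sum-supersetCost< S)) ⟩
    perturbation S ℤ.+ + (2 ℕ.* cost S)
      ≡⟨ cong (λ i → perturbation S ℤ.+ + (cost S ℕ.+ i)) (ℕₚ.+-identityʳ (cost S)) ⟩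
    perturbation S ℤ.+ (c ℤ.+ c)
      ≡⟨ ℤₚ.+-assoc (perturbation S) c c ⟨
    (perturbation S ℤ.+ c) ℤ.+ c ∎)
    where
    open ℤₚ.≤-Reasoning
    open CommutativeSemigroupProperties ℤₚ.+-commutativeSemigroup using (x∙yz≈y∙xz)
    c = + cost S
    v = ℕΣ.sum (const true) (supersetCost S)

  perturbation-large : ∀ S → ∣ S ∣ ℕ.> k → 1ℤ ℤ.≤ perturbation S
  perturbation-large S S> = +-cancelʳ-≤ (+ cost S) (ℤₚ.≤-trans
    (ℤₚ.+-monoʳ-≤ 1ℤ (large (local S) S>)) (δ<perturbation+cost S))

  perturbation-bound : ∀ S → 0ℤ ℤ.≤ perturbation S ℤ.+ + ((2 ^ m) !)
  perturbation-bound S = begin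
    0ℤ                               ≤⟨ ℤₚ.+-mono-≤ (+≤+ z≤n) (nonneg (local S)) ⟩
    1ℤ ℤ.+ δ (local S) S             ≤⟨ δ<perturbation+cost S ⟩
    perturbation S ℤ.+ + cost S      ≤⟨ ℤₚ.+-monoʳ-≤ (perturbation S) (+≤+ (cost≤2^! S)) ⟩
    perturbation S ℤ.+ + ((2 ^ m) !) ∎
    where open ℤₚ.≤-Reasoning

-- Möbius inversion for W-coefficients

module Möbius {c ℓ} (G : AbelianGroup c ℓ) where
  private module G = AbelianGroup G
  open G using (Carrier; _≈_; _∙_; ε; _⁻¹)
  open AbelianGroupProperties G
  open SubsetSum G.commutativeMonoid

  module Inversion = SubsetSumHomomorphism G.commutativeMonoid G.commutativeMonoid
    _⁻¹ ε⁻¹≈ε (λ x y → G.sym (⁻¹-∙-comm x y))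

  module _
    (sign : ℕ → Carrier → Carrier)
    (sign-zero : ∀ x → sign zero x ≈ x)
    (sign-suc : ∀ n x → sign (suc n) x ≈ sign n x ⁻¹)
    where

    -- The W-coefficient with opposite sign, which makes the recursion in the first coordinate
    -- cleaner. `signed` satisfies both laws assumed of `sign` by reflexivity.
    möbius : ∀ {m} → (Subset m → Carrier) → Subset m → Carrier
    möbius f S = sum (λ T → does ((S ∪ T) ≟ ⊤)) (λ T → sign ∣ S ∩ T ∣ (f T))

    möbius-outside : ∀ {m} (f : Subset (suc m) → Carrier) S →
      möbius f (outside ∷ S) ≈ möbius (f ∘ (inside ∷_)) S
    möbius-outside f S = G.trans
      (G.∙-cong (sum-none λ T → sign ∣ S ∩ T ∣ (f (outside ∷ T))) G.refl)
      (G.identityˡ _)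

    möbius-inside : ∀ {m} (f : Subset (suc m) → Carrier) S →
      möbius f (inside ∷ S) ≈ möbius (f ∘ (outside ∷_)) S ∙ möbius (f ∘ (inside ∷_)) S ⁻¹
    möbius-inside f S = G.∙-congˡ (G.trans
      (sum-congʳ (λ T → does ((S ∪ T) ≟ ⊤)) (λ T → sign-suc ∣ S ∩ T ∣ (f (inside ∷ T))))
      (G.sym (Inversion.sum-homo (λ T → does ((S ∪ T) ≟ ⊤))
        (λ T → sign ∣ S ∩ T ∣ (f (inside ∷ T))))))

    -- Induction on the first coordinate. If `T` contains it, S must not, and `möbius-outside`
    -- passes to fᵢ. Otherwise both kinds of S occur and contribute fᵢ T and fₒ T - fᵢ T, which add
    -- up to fₒ T.
    möbius-inversion : ∀ {m} (f : Subset m → Carrier) T →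
      sum (λ S → not (meets S T)) (möbius f) ≈ f T
    möbius-inversion f [] = sign-zero (f [])
    möbius-inversion f (inside ∷ T) = G.trans
      (G.∙-cong
        (G.trans (sum-congʳ (λ S → not (meets S T)) (möbius-outside f))
                  (möbius-inversion (f ∘ (inside ∷_)) T))
        (sum-none (möbius f ∘ (inside ∷_))))
      (G.identityʳ _)
    möbius-inversion f (outside ∷ T) = begin
      sum b (möbius f ∘ (outside ∷_)) ∙ sum b (möbius f ∘ (inside ∷_))
        ≈⟨ G.∙-cong (sum-congʳ b (möbius-outside f)) (sum-congʳ b (möbius-inside f)) ⟩
      sum b (möbius fᵢ) ∙ sum b (λ S → möbius fₒ S ∙ möbius fᵢ S ⁻¹)
        ≈⟨ G.∙-cong G.refl (sum-∙ b (möbius fₒ) (_⁻¹ ∘ möbius fᵢ)) ⟩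
      sum b (möbius fᵢ) ∙ (sum b (möbius fₒ) ∙ sum b (_⁻¹ ∘ möbius fᵢ))
        ≈⟨ G.∙-cong (möbius-inversion fᵢ T) (G.∙-cong (möbius-inversion fₒ T)
            (G.trans (G.sym (Inversion.sum-homo b (möbius fᵢ))) (G.⁻¹-cong (möbius-inversion fᵢ T)))) ⟩
      fᵢ T ∙ (fₒ T ∙ fᵢ T ⁻¹)
        ≈⟨ G.assoc (fᵢ T) (fₒ T) (fᵢ T ⁻¹) ⟨
      fᵢ T ∙ fₒ T ∙ fᵢ T ⁻¹
        ≈⟨ xyx⁻¹≈y (fᵢ T) (fₒ T) ⟩
      fₒ T ∎
      where
      open SetoidReasoning G.setoid
      b = λ S → not (meets S T)
      fᵢ = f ∘ (inside ∷_)
      fₒ = f ∘ (outside ∷_)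

    W : ∀ {m} → (Subset m → Carrier) → Subset m → Carrier
    W {m} f S =
      listSum (filter (λ T → (S ∪ T) ≟ ⊤) (allSubsets m))
        (λ T → sign (∣ S ∩ T ∣ ℕ.+ 1) (f T))

    -- The extra 1 in the exponent of the sign amounts to one inversion, which is pulled out of the
    -- sum.
    W≈möbius⁻¹ : ∀ {m} (f : Subset m → Carrier) S → W f S ≈ möbius f S ⁻¹
    W≈möbius⁻¹ {m} f S = begin
      W f S
        ≈⟨ listSum-filter (λ T → (S ∪ T) ≟ ⊤) (allSubsets m) _ ⟩
      listSum (allSubsets m) (λ T → if b T then sign (∣ S ∩ T ∣ ℕ.+ 1) (f T) else ε)
        ≈⟨ listSum-allSubsets b _ ⟩
      sum b (λ T → sign (∣ S ∩ T ∣ ℕ.+ 1) (f T))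
        ≈⟨ sum-congʳ b (λ T → G.trans
             (G.reflexive (cong (λ n → sign n (f T)) (ℕₚ.+-comm ∣ S ∩ T ∣ 1)))
             (sign-suc ∣ S ∩ T ∣ (f T))) ⟩
      sum b (λ T → sign ∣ S ∩ T ∣ (f T) ⁻¹)
        ≈⟨ Inversion.sum-homo b _ ⟨
      möbius f S ⁻¹ ∎
      where
      open SetoidReasoning G.setoid
      b = λ T → does ((S ∪ T) ≟ ⊤)

    -- By Möbius inversion the sum of `W f` over the sets avoiding `T` is the inverse of f T. At T =
    -- ⊥ this says that the sum over all sets is trivial, so the sum over the sets meeting `T` is f
    -- T.
    sum-W : ∀ {m} (f : Subset m → Carrier) → f ⊥ ≈ ε → ∀ T →
      sum (λ S → meets S T) (W f) ≈ f T
    sum-W {m} f f⊥≈ε T = x∙y⁻¹≈ε⇒x≈y _ _ (begin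
      sum (λ S → meets S T) (W f) ∙ f T ⁻¹
        ≈⟨ G.∙-cong G.refl (avoiding T) ⟨
      sum (λ S → meets S T) (W f) ∙ sum (λ S → not (meets S T)) (W f)
        ≈⟨ sum-meeting-avoiding (W f) T ⟩
      sum (λ S → not (meets S ⊥)) (W f)
        ≈⟨ avoiding ⊥ ⟩
      f ⊥ ⁻¹
        ≈⟨ G.⁻¹-cong f⊥≈ε ⟩
      ε ⁻¹
        ≈⟨ ε⁻¹≈ε ⟩
      ε ∎)
      where
      open SetoidReasoning G.setoid
      avoiding : ∀ T → sum (λ S → not (meets S T)) (W f) ≈ f T ⁻¹
      avoiding T = G.trans (sum-congʳ b (W≈möbius⁻¹ f))
        (G.trans (G.sym (Inversion.sum-homo b (möbius f))) (G.⁻¹-cong (möbius-inversion f T)))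
        where b = λ S → not (meets S T)

-- The additive group of the reals

-- A record, so that its endpoints can be inferred; _≃_ itself unfolds to a
-- function type.
infix 4 _≋_

record _≋_ (x y : ℝ) : Set where
  constructor wrap
  field unwrap : x ≃ y

open _≋_

≋-pointwise : ∀ {x y} → (∀ n → seq x n ≡ seq y n) → x ≋ y
≋-pointwise {x} {y} x≡y = wrap λ ε ε>0 → 0 , λ n _ →
  subst (ℚ._< ε) (sym (trans (cong (λ z → ℚ.∣ z ℚ.- seq y n ∣) (x≡y n))
                             (cong ℚ.∣_∣ (ℚₚ.+-inverseʳ (seq y n))))) ε>0

½-pos : ∀ {ε} → 0ℚ ℚ.< ε → 0ℚ ℚ.< ½ ℚ.* ε
½-pos {ε} ε>0 = subst (ℚ._< ½ ℚ.* ε) (ℚₚ.*-zeroʳ ½) (ℚₚ.*-monoʳ-<-pos ½ ε>0)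

∣∣-+-< : ∀ {ε} a b → ℚ.∣ a ∣ ℚ.< ½ ℚ.* ε → ℚ.∣ b ∣ ℚ.< ½ ℚ.* ε → ℚ.∣ a ℚ.+ b ∣ ℚ.< ε
∣∣-+-< {ε} a b a< b< = begin-strict
  ℚ.∣ a ℚ.+ b ∣          ≤⟨ ℚₚ.∣p+q∣≤∣p∣+∣q∣ a b ⟩
  ℚ.∣ a ∣ ℚ.+ ℚ.∣ b ∣    <⟨ ℚₚ.+-mono-< a< b< ⟩
  ½ ℚ.* ε ℚ.+ ½ ℚ.* ε    ≡⟨ ℚₚ.*-distribʳ-+ ε ½ ½ ⟨
  ℚ.1ℚ ℚ.* ε             ≡⟨ ℚₚ.*-identityˡ ε ⟩
  ε                      ∎
  where open ℚₚ.≤-Reasoning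

module ℚ-Group where
  open AbelianGroupProperties ℚₚ.+-0-abelianGroup public
  open CommutativeSemigroupProperties
    (CommutativeMonoid.commutativeSemigroup ℚₚ.+-0-commutativeMonoid) public using (interchange)

-- The common ε/2 argument behind transitivity and compatibility with addition: in both, the
-- difference to be bounded is the sum of two differences already known to be small.
≋-combine : ∀ {x y z u v w} →
  (∀ n → seq v n ℚ.- seq w n ≡ (seq x n ℚ.- seq y n) ℚ.+ (seq z n ℚ.- seq u n)) →
  x ≋ y → z ≋ u → v ≋ w
≋-combine {x} {y} {z} {u} {v} {w} eq (wrap x≃y) (wrap z≃u) = wrap close
  where
  close : v ≃ w
  close ε ε>0 with x≃y (½ ℚ.* ε) (½-pos ε>0) | z≃u (½ ℚ.* ε) (½-pos ε>0)
  ... | K , x-y< | L , z-u< = K ℕ.⊔ L , λ n n≥ → subst (λ d → ℚ.∣ d ∣ ℚ.< ε) (sym (eq n))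
    (∣∣-+-< (seq x n ℚ.- seq y n) (seq z n ℚ.- seq u n)
      (x-y< n (ℕₚ.m⊔n≤o⇒m≤o K L n≥)) (z-u< n (ℕₚ.m⊔n≤o⇒n≤o K L n≥)))

≋-refl : ∀ {x} → x ≋ x
≋-refl = ≋-pointwise λ _ → refl

≋-neg : ∀ {x y v w} → (∀ n → seq v n ℚ.- seq w n ≡ ℚ.- (seq x n ℚ.- seq y n)) → x ≋ y → v ≋ w
≋-neg {x} {y} eq (wrap x≃y) = wrap λ ε ε>0 → let K , x-y< = x≃y ε ε>0 in
  K , λ n n≥ → subst (ℚ._< ε)
    (sym (trans (cong ℚ.∣_∣ (eq n)) (ℚₚ.∣-p∣≡∣p∣ (seq x n ℚ.- seq y n)))) (x-y< n n≥)

≋-sym : ∀ {x y} → x ≋ y → y ≋ x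
≋-sym {x} {y} = ≋-neg λ n → sym (ℚ-Group.⁻¹-anti-homo-// (seq x n) (seq y n))

≋-trans : ∀ {x y z} → x ≋ y → y ≋ z → x ≋ z
≋-trans {x} {y} {z} = ≋-combine λ n → telescope (seq x n) (seq y n) (seq z n)
  where
  telescope : ∀ a b c → a ℚ.- c ≡ (a ℚ.- b) ℚ.+ (b ℚ.- c)
  telescope a b c = sym (trans (sym (ℚₚ.+-assoc (a ℚ.- b) b (ℚ.- c)))
    (cong (ℚ._- c) (ℚ-Group.//-rightDividesˡ b a)))

+-cong : ∀ {x y z u} → x ≋ y → z ≋ u → (x + z) ≋ (y + u)
+-cong {x} {y} {z} {u} = ≋-combine λ n → trans
  (cong ((seq x n ℚ.+ seq z n) ℚ.+_) (ℚₚ.neg-distrib-+ (seq y n) (seq u n)))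
  (ℚ-Group.interchange (seq x n) (seq z n) (ℚ.- seq y n) (ℚ.- seq u n))

neg-cong : ∀ {x y} → x ≋ y → (- x) ≋ (- y)
neg-cong {x} {y} = ≋-neg λ n → sym (ℚₚ.neg-distrib-+ (seq x n) (ℚ.- seq y n))

ℝ-+-abelianGroup : AbelianGroup _ _
ℝ-+-abelianGroup = record
  { Carrier = ℝ
  ; _≈_ = _≋_
  ; _∙_ = _+_
  ; ε = 0ℝ
  ; _⁻¹ = -_
  ; isAbelianGroup = record
    { isGroup = record
      { isMonoid = record
        { isSemigroup = record
          { isMagma = record
            { isEquivalence = record { refl = ≋-refl ; sym = ≋-sym ; trans = ≋-trans }
            ; ∙-cong = +-cong }
          ; assoc = λ x y z → ≋-pointwise λ n → ℚₚ.+-assoc (seq x n) (seq y n) (seq z n) }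
        ; identity = (λ x → ≋-pointwise λ n → ℚₚ.+-identityˡ (seq x n))
                   , (λ x → ≋-pointwise λ n → ℚₚ.+-identityʳ (seq x n)) }
      ; inverse = (λ x → ≋-pointwise λ n → ℚₚ.+-inverseˡ (seq x n))
                , (λ x → ≋-pointwise λ n → ℚₚ.+-inverseʳ (seq x n))
      ; ⁻¹-cong = neg-cong }
    ; comm = λ x y → ≋-pointwise λ n → ℚₚ.+-comm (seq x n) (seq y n) }
  }

module ℝ+ = AbelianGroup ℝ-+-abelianGroup

/1-homo-+ : ∀ i j → (i ℤ.+ j) ℚ./ 1 ≡ i ℚ./ 1 ℚ.+ j ℚ./ 1
-- For a variable integer the normalisation in `_/_` is stuck. With the summands as explicit
-- fractions of denominator 1, rational addition unfolds, up to products with 1.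
/1-homo-+ i j = sym (trans (cong₂ ℚ._+_ (/1≡mkℚ i) (/1≡mkℚ j))
  (cong (ℚ._/ 1) (cong₂ ℤ._+_ (ℤₚ.*-identityʳ i) (ℤₚ.*-identityʳ j))))
  where
  /1≡mkℚ : ∀ i → i ℚ./ 1 ≡ mkℚ i 0 (Coprime.sym (Coprime.1-coprimeTo ℤ.∣ i ∣))
  /1≡mkℚ i = ℚₚ.↥p/↧p≡p (mkℚ i 0 (Coprime.sym (Coprime.1-coprimeTo ℤ.∣ i ∣)))

fromℤ-homo-+ : ∀ i j → fromℤ (i ℤ.+ j) ≋ fromℤ i + fromℤ j
fromℤ-homo-+ i j = ≋-pointwise λ _ → /1-homo-+ i j

fromℤ-nonneg : ∀ n → 0ℝ ≤ fromℤ (+ n)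
fromℤ-nonneg n ε ε>0 = 0 , λ _ _ → subst (ℚ._< (+ n) ℚ./ 1 ℚ.+ ε) (ℚₚ.+-identityˡ 0ℚ)
  (ℚₚ.+-mono-≤-< {0ℚ} {+ n ℚ./ 1} (ℚₚ.nonNegative⁻¹ (+ n ℚ./ 1) ⦃ ℚₚ.normalize-nonNeg n 1 ⦄) ε>0)

-- Coverage functions with prescribed W-coefficients

module ℝΣ = SubsetSum ℝ+.commutativeMonoid

module ℤ→ℝ = SubsetSumHomomorphism ℤₚ.+-0-commutativeMonoid ℝ+.commutativeMonoid
  fromℤ (≋-refl {0ℝ}) fromℤ-homo-+

module ℕ→ℝ = SubsetSumHomomorphism ℕₚ.+-0-commutativeMonoid ℝ+.commutativeMonoid
  (fromℤ ∘ +_) (≋-refl {0ℝ}) (λ i j → fromℤ-homo-+ (+ i) (+ j))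

sum-W-coefficient : ∀ {m} (f : SetFunction m) → f ⊥ ≋ 0ℝ → ∀ T →
  ℝΣ.sum (λ S → meets S T) (W-coefficient f) ≋ f T
sum-W-coefficient = Möbius.sum-W ℝ-+-abelianGroup signed
  (λ x → ≋-refl {x}) (λ n x → ≋-refl {signed (suc n) x})

-- The universe consists of all subsets S, each of weight `v S`, and A_i is the family of those
-- containing i. Then ⋃_{i∈T} A_i is the family of the S meeting T.
weightedCoverage : ∀ {m} (v : Subset m → ℕ) →
  IsCoverage (λ T → fromℤ (+ ℕΣ.sum (λ S → meets S T) v))
weightedCoverage {m} v = record
  { f-nonneg = λ T → fromℤ-nonneg (ℕΣ.sum (λ S → meets S T) v)
  ; size     = length (allSubsets m)
  ; weight   = fromℤ ∘ +_ ∘ v ∘ lookup (allSubsets m)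
  ; w-nonneg = λ u → fromℤ-nonneg (v (lookup (allSubsets m) u))
  ; A        = incidence (allSubsets m)
  ; f-covers = λ T → unwrap (ℝ+.trans
      (ℕ→ℝ.sum-homo (λ S → meets S T) v)
      (ℝ+.sym (ℝΣ.listSum-covered (fromℤ ∘ +_ ∘ v) T))) }

-- Agreement with f* on a short list

module Realisation
  {k m : ℕ} {N : ℤ} (N> : N ℤ.> + ((2 ^ m) !))
  {f* : SetFunction m} (f*⊥≃0 : f* ⊥ ≃ 0ℝ)
  (w-small : ∀ S → Nonempty S → ∣ S ∣ ℕ.≤ k → W-coefficient f* S ≃ fromℤ N)
  (w-large : ∀ S → ∣ S ∣ ℕ.> k → W-coefficient f* S ≃ fromℤ -1ℤ)
  {𝒥 : List (Subset m)} (𝒥< : length 𝒥 ℕ.< 2 ^ k)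
  where

  -- Adding `⊥` to the list makes the total sum of the perturbation vanish. The longer list still
  -- has at most 2^k < 2^(k+1) members.
  open Perturbation k (⊥ ∷ 𝒥) (ℕₚ.≤-<-trans 𝒥< (ℕₚ.^-monoʳ-< 2 (s≤s (s≤s z≤n)) (ℕₚ.n<1+n k)))

  -- The comparison of `k` with ∣S∣ is an argument so that proofs can match on it. At the empty set,
  -- where the hypotheses prescribe no coefficient, the value is `N`, and with it `0≤w+perturbation`
  -- holds for every S.
  wOn : (S : Subset m) → k ℕ.< ∣ S ∣ ⊎ ∣ S ∣ ℕ.≤ k → ℤ
  wOn S (inj₁ _) = -1ℤ
  wOn S (inj₂ _) = N

  W≋w : ∀ S → Nonempty S → ∀ k<∨≥ → W-coefficient f* S ≋ fromℤ (wOn S k<∨≥)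
  W≋w S _   (inj₁ k<∣S∣) = wrap (w-large S k<∣S∣)
  W≋w S S≢∅ (inj₂ ∣S∣≤k) = wrap (w-small S S≢∅ ∣S∣≤k)

  0≤w+perturbation : ∀ S k<∨≥ → 0ℤ ℤ.≤ wOn S k<∨≥ ℤ.+ perturbation S
  0≤w+perturbation S (inj₁ k<∣S∣) = ℤₚ.+-monoʳ-≤ -1ℤ (perturbation-large S k<∣S∣)
  0≤w+perturbation S (inj₂ _)     = ℤₚ.≤-trans (perturbation-bound S)
    (subst (perturbation S ℤ.+ + ((2 ^ m) !) ℤ.≤_)
      (ℤₚ.+-comm (perturbation S) N) (ℤₚ.+-monoʳ-≤ (perturbation S) (ℤₚ.<⇒≤ N>)))

  w : Subset m → ℤ
  w S = wOn S (ℕₚ.<-≤-connex k ∣ S ∣)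

  v : Subset m → ℕ
  v S = ℤ.∣ w S ℤ.+ perturbation S ∣

  -- The avoiding sums vanish both at `T` and at `⊥`; the latter is the sum over all sets, and the
  -- meeting sum is their difference.
  sum-meeting-perturbation : ∀ {T} → T ∈ˡ 𝒥 → ℤΣ.sum (λ S → meets S T) perturbation ≡ 0ℤ
  sum-meeting-perturbation {T} T∈𝒥 = begin
    ℤΣ.sum (λ S → meets S T) perturbation
      ≡⟨ ℤₚ.+-identityʳ _ ⟨
    ℤΣ.sum (λ S → meets S T) perturbation ℤ.+ 0ℤ
      ≡⟨ cong (λ i → ℤΣ.sum (λ S → meets S T) perturbation ℤ.+ i)
           (sum-avoiding-perturbation (there T∈𝒥)) ⟨
    ℤΣ.sum (λ S → meets S T) perturbation ℤ.+ ℤΣ.sum (λ S → not (meets S T)) perturbation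
      ≡⟨ ℤΣ.sum-meeting-avoiding perturbation T ⟩
    ℤΣ.sum (λ S → not (meets S ⊥)) perturbation
      ≡⟨ sum-avoiding-perturbation (here refl) ⟩
    0ℤ ∎
    where open ≡-Reasoning

  sum-meeting-v : ∀ {T} → T ∈ˡ 𝒥 →
    + ℕΣ.sum (λ S → meets S T) v ≡ ℤΣ.sum (λ S → meets S T) w
  sum-meeting-v {T} T∈𝒥 = begin
    + ℕΣ.sum b v
      ≡⟨ ℕ→ℤ.sum-homo b v ⟩
    ℤΣ.sum b (+_ ∘ v)
      ≡⟨ ℤΣ.sum-congʳ b (λ S → ℤₚ.0≤i⇒+∣i∣≡i (0≤w+perturbation S (ℕₚ.<-≤-connex k ∣ S ∣))) ⟩
    ℤΣ.sum b (λ S → w S ℤ.+ perturbation S)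
      ≡⟨ ℤΣ.sum-∙ b w perturbation ⟩
    ℤΣ.sum b w ℤ.+ ℤΣ.sum b perturbation
      ≡⟨ cong (λ i → ℤΣ.sum b w ℤ.+ i) (sum-meeting-perturbation T∈𝒥) ⟩
    ℤΣ.sum b w ℤ.+ 0ℤ
      ≡⟨ ℤₚ.+-identityʳ _ ⟩
    ℤΣ.sum b w ∎
    where
    open ≡-Reasoning
    b = λ S → meets S T

  agrees : ∀ {T} → T ∈ˡ 𝒥 → fromℤ (+ ℕΣ.sum (λ S → meets S T) v) ≋ f* T
  agrees {T} T∈𝒥 = subst (λ i → fromℤ i ≋ f* T) (sym (sum-meeting-v T∈𝒥)) (begin
    fromℤ (ℤΣ.sum b w)
      ≈⟨ ℤ→ℝ.sum-homo b w ⟩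
    ℝΣ.sum b (fromℤ ∘ w)
      -- A set meeting `T` is non-empty, so its W-coefficient is one of those prescribed.
      ≈⟨ ℝΣ.sum-cong {b = b} (λ _ → refl) (λ S S∩T →
           ≋-sym (W≋w S (nonempty S S∩T) (ℕₚ.<-≤-connex k ∣ S ∣))) ⟩
    ℝΣ.sum b (W-coefficient f*)
      ≈⟨ sum-W-coefficient f* (wrap f*⊥≃0) T ⟩
    f* T ∎)
    where
    open SetoidReasoning ℝ+.setoid
    b = λ S → meets S T
    nonempty : ∀ S → meets S T ≡ true → Nonempty S
    nonempty S S∩T = let i , i∈S , _ = meets⁻ S T S∩T in i , i∈S

corollary3p2 : (k m : ℕ) → 1 ℕ.≤ k → k ℕ.< m →
    (N : ℤ) → N ℤ.> + ((2 ^ m) !) →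
    (f* : SetFunction m) →
    f* ⊥ ≃ 0ℝ →
    (∀ S → Nonempty S → ∣ S ∣ ℕ.≤ k → W-coefficient f* S ≃ fromℤ N) →
    (∀ S → ∣ S ∣ ℕ.> k → W-coefficient f* S ≃ fromℤ -1ℤ) →
    (𝒥 : List (Subset m)) → Unique 𝒥 →
    IsNonCoverageCertificate f* 𝒥 →
    length 𝒥 ℕ.≥ 2 ^ k
corollary3p2 k m _ _ N N> f* f*⊥≃0 w-small w-large 𝒥 _ certificate = ℕₚ.≮⇒≥ λ 𝒥< →
  let open Realisation N> f*⊥≃0 w-small w-large {𝒥 = 𝒥} 𝒥<
  in certificate (_ , weightedCoverage v , λ T T∈𝒥 → unwrap (agrees T∈𝒥))
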